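{- Let $X$ be a type, $\mathcal I$ a type and $\mathcal B:\mathcal I\to\mathcal P(X)$ an indexed family of subsets. Define $\mathrm{int}:\mathcal P(X)\to\mathcal P(X)$ by $\mathrm{int}\,s:=\{x:X\mid\exists\iota:\mathcal I,\ x\in\mathcal B(\iota)\otimes\mathcal B(\iota)\subseteq s\}$. Then $\mathrm{int}$ is a Moore interior operator. Moreover, if $\mathcal B$ is a basis, then $\mathrm{int}$ is an interior operator.
   Context: Framework: constructive mathematics with affine logic as internal logic (classical linear logic with weakening but without contraction). Connectives: multiplicative conjunction $\otimes$ (unit $\top$), multiplicative disjunction $\mathbin{\mathrm{par}}$ (unit $\bot$), additive conjunction $\mathbin{\&}$, additive disjunction $\oplus$, involutive negation $\neg$, linear implication $\multimap$, exponentials $!,?$; $\forall,\exists$ the usual (additive) quantifiers; $\otimes,\mathbin{\&}$ bind tighter than $\mathbin{\mathrm{par}},\oplus,\multimap$. $\Omega$ is the (impredicative) type of propositions; $\mathcal P(X):=X\to\Omega$; $x\in s$ means $s(x)$; $s\subseteq t:=\forall x,(x\in s\multimap x\in t)$; $s\boxtimes t:=\{x\mid x\in s\otimes x\in t\}$; $s\sqcap t:=\{x\mid x\in s\mathbin{\&}x\in t\}$; $X$ also denotes $\{x\mid\top\}$. Moore interior operator: $\mathrm{int}$ with (I1) $\mathrm{int}\,s\subseteq s$, (I2) $s\subseteq t\multimap\mathrm{int}\,s\subseteq\mathrm{int}\,t$, (I3) $\mathrm{int}\,s\subseteq\mathrm{int}(\mathrm{int}\,s)$, for all $s,t$. Interior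 operator: additionally (I4) $X\subseteq\mathrm{int}\,X$ and (I5) $\mathrm{int}\,s\boxtimes\mathrm{int}\,t\subseteq\mathrm{int}(s\sqcap t)$ for all $s,t$. A family $\mathcal B:\mathcal I\to\mathcal P(X)$ is a basis if (i) $\forall x:X,\exists\iota,\ x\in\mathcal B(\iota)$, and (ii) $\forall x,\iota_0,\iota_1,\ (x\in\mathcal B(\iota_0)\otimes x\in\mathcal B(\iota_1)\multimap\exists\iota_2,(x\in\mathcal B(\iota_2)\otimes(\mathcal B(\iota_2)\subseteq\mathcal B(\iota_0)\mathbin{\&}\mathcal B(\iota_2)\subseteq\mathcal B(\iota_1))))$. -}

module Defs where

open import Level using (Level; _⊔_) renaming (suc to lsuc)
open import Data.Product using (_×_; _,_)

-- Algebraic (truth-value) semantics of classical affine logic: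
-- a complete, integral, commutative, involutive residuated lattice
-- (an integral Girard quantale).  Propositions Ω are its elements,
-- ⊤ is both the unit of ⊗ and the top element (weakening),
-- negation ¬ a := a ⊸ ⊥ is involutive, ∀ / ∃ over types in Set ι are
-- the infima ⋀ / suprema ⋁.  A proposition "holds" iff it is ⊤.
record AffineAlgebra (c ℓ ι : Level) : Set (lsuc (c ⊔ ℓ ⊔ ι)) where
  infix  4 _≤_
  infixr 7 _⊗_ _&_
  infixr 5 _⊸_
  field
    Ω     : Set c
    _≤_   : Ω → Ω → Set ℓ
    ≤-refl  : ∀ {a} → a ≤ a
    ≤-trans : ∀ {a b d} → a ≤ b → b ≤ d → a ≤ d
    _⊗_   : Ω → Ω → Ω
    ⊤     : Ω
    _⊸_   : Ω → Ω → Ω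
    ⊗-comm   : ∀ a b → a ⊗ b ≤ b ⊗ a
    ⊗-assoc  : ∀ a b d → (a ⊗ b) ⊗ d ≤ a ⊗ (b ⊗ d)
    ⊗-assoc′ : ∀ a b d → a ⊗ (b ⊗ d) ≤ (a ⊗ b) ⊗ d
    ⊗-unitˡ  : ∀ a → ⊤ ⊗ a ≤ a
    ⊗-unitˡ′ : ∀ a → a ≤ ⊤ ⊗ a
    residual  : ∀ {a b d} → a ⊗ b ≤ d → a ≤ b ⊸ d
    residual′ : ∀ {a b d} → a ≤ b ⊸ d → a ⊗ b ≤ d
    ⊤-max : ∀ a → a ≤ ⊤
    _&_   : Ω → Ω → Ω
    &-π₁  : ∀ a b → a & b ≤ a
    &-π₂  : ∀ a b → a & b ≤ b
    &-⟨⟩  : ∀ {a b d} → d ≤ a → d ≤ b → d ≤ a & b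
    ⊥     : Ω
    ⊥-min : ∀ a → ⊥ ≤ a
    ¬¬-elim : ∀ a → (a ⊸ ⊥) ⊸ ⊥ ≤ a
    ⋀ : {J : Set ι} → (J → Ω) → Ω
    ⋁ : {J : Set ι} → (J → Ω) → Ω
    ⋀-lb  : ∀ {J : Set ι} (f : J → Ω) (j : J) → ⋀ f ≤ f j
    ⋀-glb : ∀ {J : Set ι} (f : J → Ω) {d} → (∀ j → d ≤ f j) → d ≤ ⋀ f
    ⋁-ub  : ∀ {J : Set ι} (f : J → Ω) (j : J) → f j ≤ ⋁ f
    ⋁-lub : ∀ {J : Set ι} (f : J → Ω) {d} → (∀ j → f j ≤ d) → ⋁ f ≤ d

module Logic {c ℓ ι : Level} (A : AffineAlgebra c ℓ ι) where
  open AffineAlgebra A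

  Holds : Ω → Set ℓ
  Holds p = ⊤ ≤ p

  𝒫 : Set ι → Set (c ⊔ ι)
  𝒫 X = X → Ω

  infix 4 _⊆_
  _⊆_ : {X : Set ι} → 𝒫 X → 𝒫 X → Ω
  s ⊆ t = ⋀ (λ x → s x ⊸ t x)

  _⊠_ : {X : Set ι} → 𝒫 X → 𝒫 X → 𝒫 X
  (s ⊠ t) x = s x ⊗ t x

  _⊓_ : {X : Set ι} → 𝒫 X → 𝒫 X → 𝒫 X
  (s ⊓ t) x = s x & t x

  full : (X : Set ι) → 𝒫 X
  full X x = ⊤

  IsMooreInterior : {X : Set ι} → (𝒫 X → 𝒫 X) → Set (c ⊔ ℓ ⊔ ι)
  IsMooreInterior {X} int =
      (∀ (s : 𝒫 X) → Holds (int s ⊆ s))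
    × (∀ (s t : 𝒫 X) → Holds ((s ⊆ t) ⊸ (int s ⊆ int t)))
    × (∀ (s : 𝒫 X) → Holds (int s ⊆ int (int s)))

  IsInterior : {X : Set ι} → (𝒫 X → 𝒫 X) → Set (c ⊔ ℓ ⊔ ι)
  IsInterior {X} int =
      IsMooreInterior int
    × Holds (full X ⊆ int (full X))
    × (∀ (s t : 𝒫 X) → Holds ((int s ⊠ int t) ⊆ int (s ⊓ t)))

  IsBasis : {X I : Set ι} → (I → 𝒫 X) → Set ℓ
  IsBasis {X} {I} B =
      Holds (⋀ λ (x : X) → ⋁ λ (i : I) → B i x)
    × Holds (⋀ λ (x : X) → ⋀ λ (i₀ : I) → ⋀ λ (i₁ : I) →
               (B i₀ x ⊗ B i₁ x) ⊸
                 (⋁ λ (i₂ : I) → B i₂ x ⊗ ((B i₂ ⊆ B i₀) & (B i₂ ⊆ B i₁))))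

  intOf : {X I : Set ι} → (I → 𝒫 X) → 𝒫 X → 𝒫 X
  intOf {X} {I} B s x = ⋁ λ (i : I) → B i x ⊗ (B i ⊆ s)

{-# OPTIONS --safe #-}
-- (I1)-(I3) need nothing about B: a witness ι of x ∈ int s also witnesses x ∈ int t
-- once s ⊆ t, and a basic set B ι ⊆ s already lies inside int s.  For (I4) the
-- covering condition supplies a basic set around each point; for (I5) witnesses ι₀, ι₁
-- of x ∈ int s and x ∈ int t are refined by the basis condition to a single ι₂ with
-- B ι₂ ⊆ s ⊓ t.
module Submission where

open import Level using (Level)
open import Data.Product using (_×_; _,_)
open import Relation.Binary.Reasoning.Syntax using (module ≤-syntax)
import Relation.Binary.Reasoning.Base.Single as SingleRelationReasoning
open import Defs

module AffineAlgebraProperties {c ℓ ι : Level} (A : AffineAlgebra c ℓ ι) where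
  open AffineAlgebra A
  open Logic A

  module ≤-Reasoning where
    open SingleRelationReasoning _≤_ ≤-refl ≤-trans public
      using (begin_; _∎)
    open SingleRelationReasoning _≤_ ≤-refl ≤-trans using (_IsRelatedTo_; ∼-go)
    open ≤-syntax _IsRelatedTo_ _IsRelatedTo_ ∼-go public

  open ≤-Reasoning

  ⊗-monoˡ-≤ : ∀ {a b d} → a ≤ b → a ⊗ d ≤ b ⊗ d
  ⊗-monoˡ-≤ a≤b = residual′ (≤-trans a≤b (residual ≤-refl))

  ⊗-monoʳ-≤ : ∀ {a b d} → a ≤ b → d ⊗ a ≤ d ⊗ b
  ⊗-monoʳ-≤ {a} {b} {d} a≤b = begin
    d ⊗ a  ≤⟨ ⊗-comm d a ⟩
    a ⊗ d  ≤⟨ ⊗-monoˡ-≤ a≤b ⟩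
    b ⊗ d  ≤⟨ ⊗-comm b d ⟩
    d ⊗ b  ∎

  ⊗-mono-≤ : ∀ {a b d e} → a ≤ b → d ≤ e → a ⊗ d ≤ b ⊗ e
  ⊗-mono-≤ a≤b d≤e = ≤-trans (⊗-monoˡ-≤ a≤b) (⊗-monoʳ-≤ d≤e)

  ⊗-unitʳ′ : ∀ a → a ≤ a ⊗ ⊤
  ⊗-unitʳ′ a = ≤-trans (⊗-unitˡ′ a) (⊗-comm ⊤ a)

  ⊗-π₁ : ∀ a b → a ⊗ b ≤ a
  ⊗-π₁ a b = begin
    a ⊗ b  ≤⟨ ⊗-monoʳ-≤ (⊤-max b) ⟩
    a ⊗ ⊤  ≤⟨ ⊗-comm a ⊤ ⟩
    ⊤ ⊗ a  ≤⟨ ⊗-unitˡ a ⟩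
    a      ∎

  ⊗-π₂ : ∀ a b → a ⊗ b ≤ b
  ⊗-π₂ a b = ≤-trans (⊗-comm a b) (⊗-π₁ b a)

  ⊗-interchange : ∀ a b d e → (a ⊗ b) ⊗ (d ⊗ e) ≤ (a ⊗ d) ⊗ (b ⊗ e)
  ⊗-interchange a b d e = begin
    (a ⊗ b) ⊗ (d ⊗ e)  ≤⟨ ⊗-assoc a b (d ⊗ e) ⟩
    a ⊗ (b ⊗ (d ⊗ e))  ≤⟨ ⊗-monoʳ-≤ (⊗-assoc′ b d e) ⟩
    a ⊗ ((b ⊗ d) ⊗ e)  ≤⟨ ⊗-monoʳ-≤ (⊗-monoˡ-≤ (⊗-comm b d)) ⟩
    a ⊗ ((d ⊗ b) ⊗ e)  ≤⟨ ⊗-monoʳ-≤ (⊗-assoc d b e) ⟩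
    a ⊗ (d ⊗ (b ⊗ e))  ≤⟨ ⊗-assoc′ a d (b ⊗ e) ⟩
    (a ⊗ d) ⊗ (b ⊗ e)  ∎

  ≤⇒Holds-⊸ : ∀ {a b} → a ≤ b → Holds (a ⊸ b)
  ≤⇒Holds-⊸ {a} a≤b = residual (≤-trans (⊗-unitˡ a) a≤b)

  Holds-⊸⇒≤ : ∀ {a b} → Holds (a ⊸ b) → a ≤ b
  Holds-⊸⇒≤ {a} ⊢a⊸b = ≤-trans (⊗-unitˡ′ a) (residual′ ⊢a⊸b)

  ⋁-mono-≤ : ∀ {J : Set ι} {f g : J → Ω} → (∀ j → f j ≤ g j) → ⋁ f ≤ ⋁ g
  ⋁-mono-≤ {g = g} f≤g = ⋁-lub _ (λ j → ≤-trans (f≤g j) (⋁-ub g j))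

  ⋁-⊗-lub : ∀ {J : Set ι} (f : J → Ω) {d e} → (∀ j → f j ⊗ d ≤ e) → ⋁ f ⊗ d ≤ e
  ⋁-⊗-lub f fd≤e = residual′ (⋁-lub f (λ j → residual (fd≤e j)))

  ⊗-⋁-lub : ∀ {J : Set ι} (f : J → Ω) {d e} → (∀ j → d ⊗ f j ≤ e) → d ⊗ ⋁ f ≤ e
  ⊗-⋁-lub f {d} df≤e =
    ≤-trans (⊗-comm d (⋁ f)) (⋁-⊗-lub f (λ j → ≤-trans (⊗-comm (f j) d) (df≤e j)))

  ⋁-⊗-⋁-lub : ∀ {J K : Set ι} (f : J → Ω) (g : K → Ω) {e} →
              (∀ j k → f j ⊗ g k ≤ e) → ⋁ f ⊗ ⋁ g ≤ e
  ⋁-⊗-⋁-lub f g fg≤e = ⋁-⊗-lub f (λ j → ⊗-⋁-lub g (fg≤e j))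

  module _ {X : Set ι} where

    ⊆-intro : ∀ {d} {s t : 𝒫 X} → (∀ x → d ⊗ s x ≤ t x) → d ≤ (s ⊆ t)
    ⊆-intro ds≤t = ⋀-glb _ (λ x → residual (ds≤t x))

    ⊆-elim : ∀ {s t : 𝒫 X} x → (s ⊆ t) ⊗ s x ≤ t x
    ⊆-elim x = residual′ (⋀-lb _ x)

    ≤⇒Holds-⊆ : ∀ {s t : 𝒫 X} → (∀ x → s x ≤ t x) → Holds (s ⊆ t)
    ≤⇒Holds-⊆ {s} s≤t = ⊆-intro (λ x → ≤-trans (⊗-unitˡ (s x)) (s≤t x))

    ⊆-full : ∀ {d} (s : 𝒫 X) → d ≤ (s ⊆ full X)
    ⊆-full s = ⊆-intro (λ x → ⊤-max _)

    ⊆-trans : ∀ {s t u : 𝒫 X} → (s ⊆ t) ⊗ (t ⊆ u) ≤ (s ⊆ u)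
    ⊆-trans {s} {t} {u} = ⊆-intro λ x → begin
      ((s ⊆ t) ⊗ (t ⊆ u)) ⊗ s x  ≤⟨ ⊗-monoˡ-≤ (⊗-comm (s ⊆ t) (t ⊆ u)) ⟩
      ((t ⊆ u) ⊗ (s ⊆ t)) ⊗ s x  ≤⟨ ⊗-assoc (t ⊆ u) (s ⊆ t) (s x) ⟩
      (t ⊆ u) ⊗ ((s ⊆ t) ⊗ s x)  ≤⟨ ⊗-monoʳ-≤ (⊆-elim x) ⟩
      (t ⊆ u) ⊗ t x              ≤⟨ ⊆-elim x ⟩
      u x                        ∎

    ⊆-⊓ : ∀ {r s t : 𝒫 X} → (r ⊆ s) & (r ⊆ t) ≤ (r ⊆ s ⊓ t)
    ⊆-⊓ {r} {s} {t} = ⊆-intro λ x → &-⟨⟩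
      (≤-trans (⊗-monoˡ-≤ (&-π₁ (r ⊆ s) (r ⊆ t))) (⊆-elim x))
      (≤-trans (⊗-monoˡ-≤ (&-π₂ (r ⊆ s) (r ⊆ t))) (⊆-elim x))

    -- Weakening discards the unused half of the ⊗ in each component of the &.
    ⊆-⊓-trans : ∀ {r s₀ t₀ s t : 𝒫 X} →
                ((r ⊆ s₀) & (r ⊆ t₀)) ⊗ ((s₀ ⊆ s) ⊗ (t₀ ⊆ t)) ≤ (r ⊆ s ⊓ t)
    ⊆-⊓-trans {r} {s₀} {t₀} {s} {t} = ≤-trans (&-⟨⟩
      (≤-trans (⊗-mono-≤ (&-π₁ _ _) (⊗-π₁ (s₀ ⊆ s) (t₀ ⊆ t))) ⊆-trans)
      (≤-trans (⊗-mono-≤ (&-π₂ _ _) (⊗-π₂ (s₀ ⊆ s) (t₀ ⊆ t))) ⊆-trans)) ⊆-⊓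

  module _ {X I : Set ι} (B : I → 𝒫 X) where

    IsCovering : Set ℓ
    IsCovering = Holds (⋀ λ (x : X) → ⋁ λ (i : I) → B i x)

    HasCommonRefinements : Set ℓ
    HasCommonRefinements =
      Holds (⋀ λ (x : X) → ⋀ λ (i₀ : I) → ⋀ λ (i₁ : I) →
               (B i₀ x ⊗ B i₁ x) ⊸
                 (⋁ λ (i₂ : I) → B i₂ x ⊗ ((B i₂ ⊆ B i₀) & (B i₂ ⊆ B i₁))))

    common-refinement : HasCommonRefinements → ∀ x i₀ i₁ →
      B i₀ x ⊗ B i₁ x ≤ (⋁ λ i₂ → B i₂ x ⊗ ((B i₂ ⊆ B i₀) & (B i₂ ⊆ B i₁)))
    common-refinement refines x i₀ i₁ =
      Holds-⊸⇒≤ (≤-trans refines (≤-trans (⋀-lb _ x) (≤-trans (⋀-lb _ i₀) (⋀-lb _ i₁))))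

    intOf-intro : ∀ i {s} x → B i x ⊗ (B i ⊆ s) ≤ intOf B s x
    intOf-intro i {s} x = ⋁-ub (λ j → B j x ⊗ (B j ⊆ s)) i

    intOf-⊆ : ∀ s x → intOf B s x ≤ s x
    intOf-⊆ s x = ⋁-lub _ (λ i → ≤-trans (⊗-comm (B i x) (B i ⊆ s)) (⊆-elim x))

    intOf-mono : ∀ s t x → (s ⊆ t) ⊗ intOf B s x ≤ intOf B t x
    intOf-mono s t x = ⊗-⋁-lub _ λ i → begin
      (s ⊆ t) ⊗ (B i x ⊗ (B i ⊆ s))  ≤⟨ ⊗-comm (s ⊆ t) _ ⟩
      (B i x ⊗ (B i ⊆ s)) ⊗ (s ⊆ t)  ≤⟨ ⊗-assoc (B i x) (B i ⊆ s) (s ⊆ t) ⟩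
      B i x ⊗ ((B i ⊆ s) ⊗ (s ⊆ t))  ≤⟨ ⊗-monoʳ-≤ ⊆-trans ⟩
      B i x ⊗ (B i ⊆ t)              ≤⟨ intOf-intro i x ⟩
      intOf B t x                    ∎

    ⊆-intOf : ∀ i s → (B i ⊆ s) ≤ (B i ⊆ intOf B s)
    ⊆-intOf i s = ⊆-intro (λ y → ≤-trans (⊗-comm (B i ⊆ s) (B i y)) (intOf-intro i y))

    intOf-idem : ∀ s x → intOf B s x ≤ intOf B (intOf B s) x
    intOf-idem s x = ⋁-mono-≤ (λ i → ⊗-monoʳ-≤ (⊆-intOf i s))

    full-⊆-intOf : IsCovering → ∀ x → full X x ≤ intOf B (full X) x
    full-⊆-intOf covers x = begin
      ⊤                                 ≤⟨ ≤-trans covers (⋀-lb _ x) ⟩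
      (⋁ λ i → B i x)                   ≤⟨ ⋁-mono-≤ (λ i → ⊗-unitʳ′ (B i x)) ⟩
      (⋁ λ i → B i x ⊗ ⊤)               ≤⟨ ⋁-mono-≤ (λ i → ⊗-monoʳ-≤ (⊆-full (B i))) ⟩
      intOf B (full X) x                ∎

    intOf-⊠ : HasCommonRefinements → ∀ s t x →
              (intOf B s ⊠ intOf B t) x ≤ intOf B (s ⊓ t) x
    intOf-⊠ refines s t x = ⋁-⊗-⋁-lub _ _ λ i j → begin
      (B i x ⊗ (B i ⊆ s)) ⊗ (B j x ⊗ (B j ⊆ t))
        ≤⟨ ⊗-interchange (B i x) (B i ⊆ s) (B j x) (B j ⊆ t) ⟩
      (B i x ⊗ B j x) ⊗ ((B i ⊆ s) ⊗ (B j ⊆ t))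
        ≤⟨ ⊗-monoˡ-≤ (common-refinement refines x i j) ⟩
      (⋁ λ k → B k x ⊗ ((B k ⊆ B i) & (B k ⊆ B j))) ⊗ ((B i ⊆ s) ⊗ (B j ⊆ t))
        ≤⟨ ⋁-⊗-lub _ (λ k → ≤-trans (⊗-assoc _ _ _)
                              (≤-trans (⊗-monoʳ-≤ ⊆-⊓-trans) (intOf-intro k x))) ⟩
      intOf B (s ⊓ t) x
        ∎

proposition7 : ∀ {c ℓ ι : Level} (A : AffineAlgebra c ℓ ι) (X I : Set ι)
    (B : I → Logic.𝒫 A X) →
    Logic.IsMooreInterior A (Logic.intOf A B)
    × (Logic.IsBasis A B → Logic.IsInterior A (Logic.intOf A B))
proposition7 A X I B = isMooreInterior , λ { (covers , refines) →
    isMooreInterior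
  , ≤⇒Holds-⊆ (full-⊆-intOf B covers)
  , λ s t → ≤⇒Holds-⊆ (intOf-⊠ B refines s t) }
  where
  open AffineAlgebraProperties A

  isMooreInterior : Logic.IsMooreInterior A (Logic.intOf A B)
  isMooreInterior =
      (λ s → ≤⇒Holds-⊆ (intOf-⊆ B s))
    , (λ s t → ≤⇒Holds-⊸ (⊆-intro (intOf-mono B s t)))
    , (λ s → ≤⇒Holds-⊆ (intOf-idem B s))
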